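{- Let $m\geq 1$ and let $G_1,\ldots,G_m$ be connected finite simple graphs, each containing at least one edge. Let $\bigvee_{i=1}^{m}G_i$ be a finite iterated wedge of them. Then $$\operatorname{gscat}\left(\bigvee_{i=1}^{m}G_i\right)=\max_{1\leq i\leq m}\operatorname{gscat}(G_i),$$ where $\operatorname{gscat}$ denotes the simplicial geometric category.
   Context: All graphs are finite and simple; all simplicial complexes are finite abstract simplicial complexes. A graph is regarded as a simplicial complex of dimension at most one (its vertices and edges being the simplices) whenever $\operatorname{gscat}$ is applied to it. Strong collapse: let $K$ be a simplicial complex and $u\neq v$ vertices of $K$. The vertex $v$ is dominated by $u$ if every maximal simplex of $K$ containing $v$ also contains $u$. In this case, deleting $v$ together with all simplices containing it is called an elementary strong collapse. A strong collapse is a finite sequence of elementary strong collapses. $K$ is strongly collapsible if it strongly collapses to a single vertex (a single vertex is itself strongly collapsible). Simplicial geometric category: $\operatorname{gscat}(K)$ is the least integer $m\geq 0$ such that $K=C_0\cup C_1\cup\cdots\cup C_m$, where each $C_i$ is a strongly collapsible subcomplex of $K$. Wedge: if $K$ and $L$ are graphs sharing exactly one vertex $v$ and otherwise disjoint, then $K\vee_v L$ is their union, i.e. the graph with vertex set $V(K)\cup V(L)$ and edge set $E(K)\cup E(L)$. More generally, one chooses a vertex in each of two disjoint graphs and identifies the two chosen vertices. Iterated wedge: $\bigvee_{i=1}^{m}G_i$ denotes a graph $W_m$ obtained by $W_1=G_1$ and, for $2\le k\le m$, $W_k=W_{k-1}\vee_{v_k} G_k$, where at each step the wedge is formed by identifying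 some chosen vertex of $W_{k-1}$ with some chosen vertex of $G_k$ (the choice of vertices being arbitrary). -}

module Defs where

open import Data.Bool.Base using (Bool; true; false; T)
open import Data.Bool.Properties as Bool using (T?)
open import Data.Fin.Base as Fin using (Fin; zero; suc; inject₁; fromℕ)
open import Data.Fin.Properties as Fin using (any?; finToFun-funToFin)
open import Data.Fin.Subset
  using (Subset; inside; outside; ⁅_⁆; _∈_; _∉_; _⊆_; _∪_; _-_; ∣_∣; Nonempty)
open import Data.Fin.Subset.Properties
  using ( _∈?_; _⊆?_; nonempty?; anySubset?; ⊆-refl; ⊆-trans; ⊆-antisym
        ; ⊆-reflexive; x∈⁅x⁆; x∈⁅y⁆⇒x≡y; x∈p∪q⁻; x∈p∪q⁺
        ; p─q⊆p; x∈p∧x≢y⇒x∈p-y; x∈p⇒∣p-x∣<∣p∣; p⊂q⇒∣p∣<∣q∣)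
open import Data.Nat.Base using (ℕ; zero; suc; _≤_; _<_; _^_; z≤n; s≤s; s≤s⁻¹)
open import Data.Nat.Properties using (<-≤-trans; n<1+n)
open import Data.Product using (∃; ∃₂; _×_; _,_; proj₁; proj₂)
open import Data.Sum using (_⊎_; inj₁; inj₂)
open import Data.Vec.Base as Vec using ([]; _∷_)
open import Data.Vec.Functional as Vector using (Vector)
open import Data.Vec.Properties
  using (≡-dec; []=⇒lookup; lookup⇒[]=; lookup∘tabulate; tabulate-cong; tabulate∘lookup)
open import Function.Base using (_∘_; const; case_of_)
open import Function.Bundles using (_⇔_)
open import Function.Definitions using (Injective)
open import Level using (Level; 0ℓ)
open import Relation.Binary.Construct.Closure.ReflexiveTransitive using (Star; ε; _◅_)
open import Relation.Binary.Core using (Rel)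
import Relation.Binary.Definitions as B
open import Relation.Binary.PropositionalEquality
  using (_≡_; _≢_; _≗_; refl; sym; trans; cong; subst)
open import Relation.Nullary
  using (Dec; yes; no; does; ¬_; ¬?; contradiction; _×-dec_; _⊎-dec_; _→-dec_)
open import Relation.Nullary.Decidable
  using (map′; ⌊_⌋; toWitness; fromWitness; decidable-stable)
open import Relation.Unary using (Pred; Decidable; _≐_; ｛_｝; ⋃)

private
  variable
    a ℓ p : Level
    m n : ℕ

-- The ambient set Fin n may be larger than the vertex set: only those v
-- with Vertex K v are vertices of K.  In particular a subcomplex of K,
-- on fewer vertices, has the same type as K.

record Complex (n : ℕ) : Set₁ where
  field
    Simplex     : Pred (Subset n) 0ℓ
    simplex?    : Decidable Simplex
    nonempty    : ∀ {s} → Simplex s → Nonempty s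
    down-closed : ∀ {s t} → Simplex s → Nonempty t → t ⊆ s → Simplex t

open Complex public

Vertex : Complex n → Pred (Fin n) 0ℓ
Vertex K v = Simplex K ⁅ v ⁆

Maximal : Complex n → Pred (Subset n) 0ℓ
Maximal K s = Simplex K s × (∀ t → Simplex K t → s ⊆ t → t ≡ s)

record Dominated (K : Complex n) (v u : Fin n) : Set where
  constructor dominated
  field
    distinct  : u ≢ v
    vertexᵛ   : Vertex K v
    vertexᵘ   : Vertex K u
    dominates : ∀ s → Maximal K s → v ∈ s → u ∈ s

infixl 6 _∖_

_∖_ : Complex n → Fin n → Complex n
K ∖ v = record
  { Simplex     = λ s → Simplex K s × v ∉ s
  ; simplex?    = λ s → simplex? K s ×-dec ¬? (v ∈? s)
  ; nonempty    = nonempty K ∘ proj₁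
  ; down-closed = λ (s∈K , v∉s) t≠∅ t⊆s → down-closed K s∈K t≠∅ t⊆s , v∉s ∘ t⊆s
  }

infix 4 _↘_

data _↘_ {n} (K : Complex n) : Complex n → Set where
  collapse : ∀ {v u} → Dominated K v u → K ↘ K ∖ v

IsSingleVertex : Pred (Complex n) 0ℓ
IsSingleVertex K = ∃ λ v → Simplex K ≐ ｛ ⁅ v ⁆ ｝

StronglyCollapsible : Complex n → Set₁
StronglyCollapsible K = ∃ λ L → Star _↘_ K L × IsSingleVertex L

-- There are m + 1 parts C₀ , … , Cₘ, so a strongly collapsible complex has
-- category 0.

record Cover (K : Complex n) (m : ℕ) : Set₁ where
  constructor cover
  field
    part        : Fin (suc m) → Complex n
    collapsible : ∀ i → StronglyCollapsible (part i)
    union       : Simplex K ≐ ⋃ (Fin (suc m)) (λ i → Simplex (part i))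

IsLeast : Pred ℕ ℓ → Pred ℕ ℓ
IsLeast P k = P k × (∀ j → P j → k ≤ j)

-- The least m with Cover K m exists for every K with a vertex: having a
-- cover of a given size is decidable, and K is covered by its simplices.

private

  allSubset? : {P : Pred (Subset n) ℓ} → Decidable P → Dec (∀ s → P s)
  allSubset? P? with anySubset? (¬? ∘ P?)
  ... | yes (s , ¬Ps) = no λ ∀P → ¬Ps (∀P s)
  ... | no ¬∃         = yes λ s → decidable-stable (P? s) λ ¬Ps → ¬∃ (s , ¬Ps)

  ≐? : {P Q : Pred (Subset n) 0ℓ} → Decidable P → Decidable Q → Dec (P ≐ Q)
  ≐? P? Q? = map′ (λ (f , g) → (λ {s} → f s) , (λ {s} → g s))
                  (λ (f , g) → (λ s → f {s}) , (λ s → g {s}))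
                  (allSubset? (λ s → P? s →-dec Q? s) ×-dec
                   allSubset? (λ s → Q? s →-dec P? s))

  Searchable : (A : Set a) → Rel A ℓ → (p : Level) → Set _
  Searchable A _≈_ p = {P : Pred A p} → (∀ {x y} → x ≈ y → P x → P y) →
                       Decidable P → Dec (∃ P)

  families : {A : Set a} {_≈_ : Rel A ℓ} → (∀ {x} → x ≈ x) →
             (∀ {p} → Searchable A _≈_ p) →
             ∀ k {p} → Searchable (Vector A k) (λ f g → ∀ i → f i ≈ g i) p
  families rfl search zero resp P? =
    map′ (_ ,_) (λ (f , Pf) → resp (λ ()) Pf) (P? Vector.[])
  families {_≈_ = _≈_} rfl search (suc k) {P = P} resp P? =
    map′ (λ (x , f , Pxf) → x Vector.∷ f , Pxf)
         (λ (f , Pf) → f zero , f ∘ suc , resp (η f) Pf)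
         (search (λ x≈y (f , Pf) → f , resp (head≈ x≈y) Pf)
                 λ x → families rfl search k (λ f≈g → resp (tail≈ f≈g))
                                             (λ f → P? (x Vector.∷ f)))
    where
    η : ∀ f i → f i ≈ (f zero Vector.∷ (f ∘ suc)) i
    η f zero    = rfl
    η f (suc i) = rfl

    head≈ : ∀ {x y f} → x ≈ y → ∀ i → (x Vector.∷ f) i ≈ (y Vector.∷ f) i
    head≈ x≈y zero    = x≈y
    head≈ x≈y (suc i) = rfl

    tail≈ : ∀ {x f g} → (∀ i → f i ≈ g i) →
            ∀ i → (x Vector.∷ f) i ≈ (x Vector.∷ g) i
    tail≈ f≈g zero    = rfl
    tail≈ f≈g (suc i) = f≈g i

  tests : ∀ n {p} → Searchable (Subset n → Bool) _≗_ p
  tests zero {P = P} resp P? =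
    map′ (λ { (inj₁ h) → _ , h ; (inj₂ h) → _ , h }) (λ (f , h) → split f (f []) refl h)
         (P? (const true) ⊎-dec P? (const false))
    where
    split : ∀ f b → f [] ≡ b → P f → P (const true) ⊎ P (const false)
    split f true  eq h = inj₁ (resp (λ { [] → eq }) h)
    split f false eq h = inj₂ (resp (λ { [] → eq }) h)
  tests (suc n) resp P? =
    map′ (λ (f , g , h) → join f g , h)
         (λ (f , h) → f ∘ (inside ∷_) , f ∘ (outside ∷_) , resp (η f) h)
         (tests n (λ e (g , h) → g , resp (join-cong e (λ _ → refl)) h) λ f →
          tests n (λ e → resp (join-cong (λ _ → refl) e)) λ g →
          P? (join f g))
    where
    join : (f g : Subset n → Bool) → Subset (suc n) → Bool
    join f g (inside  ∷ s) = f s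
    join f g (outside ∷ s) = g s

    join-cong : ∀ {f f′ g g′} → f ≗ f′ → g ≗ g′ → join f g ≗ join f′ g′
    join-cong e e′ (inside  ∷ s) = e s
    join-cong e e′ (outside ∷ s) = e′ s

    η : ∀ f → f ≗ join (f ∘ (inside ∷_)) (f ∘ (outside ∷_))
    η f (inside  ∷ s) = refl
    η f (outside ∷ s) = refl

  _≈ᶜ_ : Rel (Complex n) 0ℓ
  K ≈ᶜ L = Simplex K ≐ Simplex L

  ≈ᶜ-sym : {K L : Complex n} → K ≈ᶜ L → L ≈ᶜ K
  ≈ᶜ-sym (f , g) = g , f

  generated : (Subset n → Bool) → Complex n
  generated b = record
    { Simplex     = λ s → Nonempty s × ∃ λ t → T (b t) × s ⊆ t
    ; simplex?    = λ s → nonempty? s ×-dec anySubset? λ t → T? (b t) ×-dec (s ⊆? t)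
    ; nonempty    = proj₁
    ; down-closed = λ (_ , t , bt , s⊆t) r≠∅ r⊆s → r≠∅ , t , bt , ⊆-trans r⊆s s⊆t
    }

  complexes : ∀ {p} → Searchable (Complex n) _≈ᶜ_ p
  complexes resp P? =
    map′ (λ (b , h) → generated b , h)
         (λ (K , h) → (λ t → ⌊ simplex? K t ⌋) , resp (regenerate K) h)
         (tests _ (λ b≗c → resp (⊆gen b≗c , ⊆gen (sym ∘ b≗c))) (P? ∘ generated))
    where
    ⊆gen : ∀ {b c : Subset n → Bool} → b ≗ c →
           ∀ {s} → Simplex (generated b) s → Simplex (generated c) s
    ⊆gen b≗c (s≠∅ , t , bt , s⊆t) = s≠∅ , t , subst T (b≗c t) bt , s⊆t

    regenerate : (K : Complex n) → K ≈ᶜ generated (λ t → ⌊ simplex? K t ⌋)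
    regenerate K =
      (λ {s} s∈K → nonempty K s∈K , s , fromWitness s∈K , ⊆-refl) ,
      (λ (s≠∅ , t , t∈K , s⊆t) → down-closed K (toWitness t∈K) s≠∅ s⊆t)

  maximal? : (K : Complex n) → Decidable (Maximal K)
  maximal? K s = simplex? K s ×-dec allSubset? λ t →
    simplex? K t →-dec (s ⊆? t) →-dec ≡-dec Bool._≟_ t s

  dominated? : (K : Complex n) → B.Decidable (Dominated K)
  dominated? K v u =
    map′ (λ (d , v∈K , u∈K , h) → dominated d v∈K u∈K h)
         (λ (dominated d v∈K u∈K h) → d , v∈K , u∈K , h)
         (¬? (u Fin.≟ v) ×-dec simplex? K ⁅ v ⁆ ×-dec simplex? K ⁅ u ⁆ ×-dec
          allSubset? λ s → maximal? K s →-dec (v ∈? s) →-dec (u ∈? s))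

  singleVertex? : Decidable (IsSingleVertex {n})
  singleVertex? K = any? λ v → ≐? (simplex? K) (≡-dec Bool._≟_ ⁅ v ⁆)

  vertices : Complex n → Subset n
  vertices K = Vec.tabulate λ v → ⌊ simplex? K ⁅ v ⁆ ⌋

  ∈-vertices⁺ : (K : Complex n) {v : Fin n} → Vertex K v → v ∈ vertices K
  ∈-vertices⁺ K {v} v∈K with simplex? K ⁅ v ⁆ in eq
  ... | yes _  = lookup⇒[]= v _ (trans (lookup∘tabulate _ v) (cong ⌊_⌋ eq))
  ... | no v∉K = contradiction v∈K v∉K

  ∈-vertices⁻ : (K : Complex n) {v : Fin n} → v ∈ vertices K → Vertex K v
  ∈-vertices⁻ K {v} v∈ =
    toWitness (subst T (trans (sym ([]=⇒lookup v∈)) (lookup∘tabulate _ v)) _)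

  ∖-shrinks : (K : Complex n) {v : Fin n} → Vertex K v →
              ∣ vertices (K ∖ v) ∣ < ∣ vertices K ∣
  ∖-shrinks K {v} v∈K = p⊂q⇒∣p∣<∣q∣
    ( (λ x∈ → ∈-vertices⁺ K (proj₁ (∈-vertices⁻ (K ∖ v) x∈)))
    , v , ∈-vertices⁺ K v∈K , λ v∈ → proj₂ (∈-vertices⁻ (K ∖ v) v∈) (x∈⁅x⁆ v))

  ∖-cong : {K L : Complex n} (v : Fin n) → K ≈ᶜ L → (K ∖ v) ≈ᶜ (L ∖ v)
  ∖-cong v (f , g) = (λ (s∈K , v∉s) → f s∈K , v∉s) , (λ (s∈L , v∉s) → g s∈L , v∉s)

  dominated-resp : {K L : Complex n} {v u : Fin n} → K ≈ᶜ L →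
                   Dominated K v u → Dominated L v u
  dominated-resp (f , g) (dominated d v∈K u∈K h) =
    dominated d (f v∈K) (f u∈K) λ s (s∈L , max) →
      h s (g s∈L , λ t t∈K → max t (f t∈K))

stronglyCollapsible-resp : {K L : Complex n} → Simplex K ≐ Simplex L →
                           StronglyCollapsible K → StronglyCollapsible L
stronglyCollapsible-resp {L = L} (f , g) (_ , ε , v , h , k) =
  L , ε , v , (λ s∈L → h (g s∈L)) , (λ e → f (k e))
stronglyCollapsible-resp {K = K} {L = L} K≈L (M , collapse {v} d ◅ ds , pt)
  with stronglyCollapsible-resp {L = L ∖ v} (∖-cong {K = K} {L = L} v K≈L) (M , ds , pt)
... | M′ , ds′ , pt′ = M′ , collapse (dominated-resp {K = K} {L = L} K≈L d) ◅ ds′ , pt′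

private

  stronglyCollapsible?′ : ∀ k (K : Complex n) → ∣ vertices K ∣ < k →
                          Dec (StronglyCollapsible K)
  stronglyCollapsible?′ (suc k) K lt =
    map′ (λ { (inj₁ pt) → K , ε , pt
            ; (inj₂ (v , u , d , L , ds , pt)) → L , collapse d ◅ ds , pt })
         (λ { (_ , ε , pt) → inj₁ pt
            ; (L , collapse d ◅ ds , pt) → inj₂ (_ , _ , d , L , ds , pt) })
         (singleVertex? K ⊎-dec any? λ v → any? λ u → step v u)
    where
    step : ∀ v u → Dec (Dominated K v u × StronglyCollapsible (K ∖ v))
    step v u with dominated? K v u
    ... | no ¬d = no (¬d ∘ proj₁)
    ... | yes d = map′ (d ,_) proj₂ (stronglyCollapsible?′ k (K ∖ v)
                    (<-≤-trans (∖-shrinks K (Dominated.vertexᵛ d)) (s≤s⁻¹ lt)))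

stronglyCollapsible? : Decidable (StronglyCollapsible {n})
stronglyCollapsible? K = stronglyCollapsible?′ _ K (n<1+n _)

cover? : (K : Complex n) → Decidable (Cover K)
cover? K m =
  map′ (λ (C , sc , eq) → cover C sc eq) (λ (cover C sc eq) → C , sc , eq)
       (families {_≈_ = _≈ᶜ_} (λ {K} → (λ s∈K → s∈K) , (λ s∈K → s∈K)) complexes (suc m)
          (λ {C} {D} C≈D (sc , f , g) →
            (λ i → stronglyCollapsible-resp (C≈D i) (sc i)) ,
            (λ s∈K → let (i , s∈C) = f s∈K in i , proj₁ (C≈D i) s∈C) ,
            (λ (i , s∈D) → g (i , proj₂ (C≈D i) s∈D)))
          (λ C → Fin.all? (stronglyCollapsible? ∘ C) ×-dec
                 ≐? (simplex? K) (λ s → any? λ i → simplex? (C i) s)))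

private

  Δ : Subset n → Complex n
  Δ s = record
    { Simplex     = λ t → Nonempty t × t ⊆ s
    ; simplex?    = λ t → nonempty? t ×-dec (t ⊆? s)
    ; nonempty    = proj₁
    ; down-closed = λ (_ , t⊆s) r≠∅ r⊆t → r≠∅ , ⊆-trans r⊆t t⊆s
    }

  ⁅⁆⊆ : {v : Fin n} {s : Subset n} → v ∈ s → ⁅ v ⁆ ⊆ s
  ⁅⁆⊆ {v = v} {s} v∈s x∈ = subst (_∈ s) (sym (x∈⁅y⁆⇒x≡y v x∈)) v∈s

  ∉- : (s : Subset n) (v : Fin n) → v ∉ s - v
  ∉- (x ∷ s) zero    ()
  ∉- (x ∷ s) (suc v) (Vec.there v∈) = ∉- s v v∈

  Δ-vertex : {v : Fin n} {s : Subset n} → v ∈ s → Vertex (Δ s) v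
  Δ-vertex {v = v} v∈s = (v , x∈⁅x⁆ v) , ⁅⁆⊆ v∈s

  Δ-collapsible : ∀ k (s : Subset n) → ∣ s ∣ < k → ∀ {u} → u ∈ s →
                  StronglyCollapsible (Δ s)
  Δ-collapsible (suc k) s lt {u} u∈s
    with any? (λ v → (v ∈? s) ×-dec ¬? (u Fin.≟ v))
  ... | no ¬∃ = Δ s , ε , u ,
        (λ ((x , x∈t) , t⊆s) → ⊆-antisym
          (⁅⁆⊆ (subst (_∈ _) (sym (u≡ (t⊆s x∈t))) x∈t))
          (λ y∈t → subst (_∈ ⁅ u ⁆) (u≡ (t⊆s y∈t)) (x∈⁅x⁆ u))) ,
        λ { refl → Δ-vertex u∈s }
    where
    u≡ : ∀ {x} → x ∈ s → u ≡ x
    u≡ {x} x∈s = decidable-stable (u Fin.≟ x) λ u≢x → ¬∃ (x , x∈s , u≢x)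
  ... | yes (v , v∈s , u≢v)
    with stronglyCollapsible-resp {K = Δ (s - v)} {L = Δ s ∖ v}
           ( (λ (t≠∅ , t⊆) → (t≠∅ , ⊆-trans t⊆ (p─q⊆p s ⁅ v ⁆)) , ∉- s v ∘ t⊆)
           , (λ { ((t≠∅ , t⊆s) , v∉t) → t≠∅ , λ {x} x∈t →
                  x∈p∧x≢y⇒x∈p-y (t⊆s x∈t) λ { refl → v∉t x∈t } }))
           (Δ-collapsible k (s - v) (<-≤-trans (x∈p⇒∣p-x∣<∣p∣ v∈s) (s≤s⁻¹ lt))
              (x∈p∧x≢y⇒x∈p-y u∈s u≢v))
  ... | L , ds , pt =
        L , collapse (dominated u≢v (Δ-vertex v∈s) (Δ-vertex u∈s) u∈max) ◅ ds , pt
    where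
    u∈max : ∀ t → Maximal (Δ s) t → v ∈ t → u ∈ t
    u∈max t ((_ , t⊆s) , max) _ = subst (u ∈_) (max s ((u , u∈s) , ⊆-refl) t⊆s) u∈s

  toBool : Fin 2 → Bool
  toBool zero    = outside
  toBool (suc _) = inside

  fromBool : Bool → Fin 2
  fromBool false = zero
  fromBool true  = suc zero

  toBool∘fromBool : ∀ b → toBool (fromBool b) ≡ b
  toBool∘fromBool false = refl
  toBool∘fromBool true  = refl

  nth : Fin (2 ^ n) → Subset n
  nth i = Vec.tabulate (toBool ∘ Fin.finToFun i)

  index : Subset n → Fin (2 ^ n)
  index s = Fin.funToFin (fromBool ∘ Vec.lookup s)

  nth∘index : (s : Subset n) → nth (index s) ≡ s
  nth∘index s = trans
    (tabulate-cong λ i → trans (cong toBool (finToFun-funToFin _ i)) (toBool∘fromBool _))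
    (tabulate∘lookup s)

  module _ (K : Complex n) {v : Fin n} (v∈K : Vertex K v) where

    choose : ∀ s → Dec (Simplex K s) → ∃ λ t → Simplex K t
    choose s (yes s∈K) = s , s∈K
    choose s (no  _)   = ⁅ v ⁆ , v∈K

    face : Fin (suc (2 ^ n)) → ∃ λ t → Simplex K t
    face zero    = ⁅ v ⁆ , v∈K
    face (suc i) = choose (nth i) (simplex? K (nth i))

    ⊆face : ∀ {s} → Simplex K s → s ⊆ proj₁ (face (suc (index s)))
    ⊆face {s} s∈K with simplex? K (nth (index s))
    ... | yes _ = ⊆-reflexive (sym (nth∘index s))
    ... | no ∉K = contradiction (subst (Simplex K) (sym (nth∘index s)) s∈K) ∉K

    coverBySimplices : Cover K (2 ^ n)
    coverBySimplices = cover (Δ ∘ proj₁ ∘ face)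
      (λ i → let (t , t∈K) = face i in
             Δ-collapsible _ t (n<1+n _) (proj₂ (nonempty K t∈K)))
      ( (λ {s} s∈K → suc (index s) , nonempty K s∈K , ⊆face s∈K)
      , (λ (i , s≠∅ , s⊆t) → down-closed K (proj₂ (face i)) s≠∅ s⊆t))

  least : {P : Pred ℕ ℓ} → Decidable P → ∀ k → P k → ∃ (IsLeast P)
  least P? k Pk with P? 0
  least P? k       Pk | yes P0 = 0 , P0 , λ _ _ → z≤n
  least P? zero    Pk | no ¬P0 = contradiction Pk ¬P0
  least P? (suc k) Pk | no ¬P0 with least (P? ∘ suc) k Pk
  ... | l , Pl , min = suc l , Pl , λ { zero    P0 → contradiction P0 ¬P0
                                      ; (suc j) Pj → s≤s (min j Pj) }

abstract
  leastCover : (K : Complex n) {v : Fin n} → Vertex K v → ∃ (IsLeast (Cover K))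
  leastCover K v∈K = least (cover? K) _ (coverBySimplices K v∈K)

-- The least m with Cover K m (see gscat-isLeast).  The complex without
-- simplices has no cover at all; it gets the arbitrary value 0.

gscat : Complex n → ℕ
gscat K with any? (λ v → simplex? K ⁅ v ⁆)
... | yes (v , v∈K) = proj₁ (leastCover K v∈K)
... | no  _         = 0

gscat-isLeast : (K : Complex n) {v : Fin n} → Vertex K v → IsLeast (Cover K) (gscat K)
gscat-isLeast K v∈K with any? (λ v → simplex? K ⁅ v ⁆)
... | yes (v , v∈K) = proj₂ (leastCover K v∈K)
... | no ¬∃         = contradiction (_ , v∈K) ¬∃

record Graph : Set₁ where
  field
    order  : ℕ
    _—_    : Rel (Fin order) 0ℓ
    _—?_   : B.Decidable _—_
    —-sym  : B.Symmetric _—_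
    —-irr  : ∀ {v} → ¬ (v — v)

open Graph public using (order)

Edge : (G : Graph) → Rel (Fin (order G)) 0ℓ
Edge = Graph._—_

HasEdge : Graph → Set
HasEdge G = ∃₂ (Edge G)

Connected : Graph → Set
Connected G = ∀ u v → Star (Edge G) u v

complex : (G : Graph) → Complex (order G)
complex G = record
  { Simplex     = λ s → IsVertex s ⊎ IsEdge s
  ; simplex?    = λ s → any? (λ v → s ≟ˢ ⁅ v ⁆) ⊎-dec
                        any? (λ u → any? λ v → (u —? v) ×-dec (s ≟ˢ (⁅ u ⁆ ∪ ⁅ v ⁆)))
  ; nonempty    = λ { (inj₁ (v , refl))         → v , x∈⁅x⁆ v
                    ; (inj₂ (u , v , _ , refl)) → u , x∈p∪q⁺ (inj₁ (x∈⁅x⁆ u)) }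
  ; down-closed = closed
  }
  where
  open Graph G
  _≟ˢ_ = ≡-dec {n = order G} Bool._≟_

  IsVertex IsEdge : Pred (Subset (order G)) 0ℓ
  IsVertex s = ∃ λ v → s ≡ ⁅ v ⁆
  IsEdge   s = ∃₂ λ u v → u — v × s ≡ ⁅ u ⁆ ∪ ⁅ v ⁆

  closed : ∀ {s t} → IsVertex s ⊎ IsEdge s → Nonempty t → t ⊆ s → IsVertex t ⊎ IsEdge t
  closed {t = t} (inj₁ (v , refl)) (x , x∈t) t⊆s =
    inj₁ (v , ⊆-antisym t⊆s (⁅⁆⊆ (subst (_∈ t) (x∈⁅y⁆⇒x≡y v (t⊆s x∈t)) x∈t)))
  closed {t = t} (inj₂ (u , v , u—v , refl)) (x , x∈t) t⊆s with u ∈? t | v ∈? t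
  ... | yes u∈t | yes v∈t = inj₂ (u , v , u—v , ⊆-antisym t⊆s λ y∈ →
          case x∈p∪q⁻ ⁅ u ⁆ ⁅ v ⁆ y∈ of λ { (inj₁ y∈u) → ⁅⁆⊆ u∈t y∈u
                                          ; (inj₂ y∈v) → ⁅⁆⊆ v∈t y∈v })
  ... | yes u∈t | no v∉t = inj₁ (u , ⊆-antisym (λ y∈t →
          case x∈p∪q⁻ ⁅ u ⁆ ⁅ v ⁆ (t⊆s y∈t) of λ
            { (inj₁ y∈u) → y∈u
            ; (inj₂ y∈v) → contradiction (subst (_∈ t) (x∈⁅y⁆⇒x≡y v y∈v) y∈t) v∉t })
          (⁅⁆⊆ u∈t))
  ... | no u∉t | yes v∈t = inj₁ (v , ⊆-antisym (λ y∈t →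
          case x∈p∪q⁻ ⁅ u ⁆ ⁅ v ⁆ (t⊆s y∈t) of λ
            { (inj₁ y∈u) → contradiction (subst (_∈ t) (x∈⁅y⁆⇒x≡y u y∈u) y∈t) u∉t
            ; (inj₂ y∈v) → y∈v })
          (⁅⁆⊆ v∈t))
  ... | no u∉t | no v∉t = case x∈p∪q⁻ ⁅ u ⁆ ⁅ v ⁆ (t⊆s x∈t) of λ
            { (inj₁ x∈u) → contradiction (subst (_∈ t) (x∈⁅y⁆⇒x≡y u x∈u) x∈t) u∉t
            ; (inj₂ x∈v) → contradiction (subst (_∈ t) (x∈⁅y⁆⇒x≡y v x∈v) x∈t) v∉t }

-- W is the union of a copy of K and a copy of L which share exactly the
-- vertex to which both k and l are sent.

record IsWedge (K L : Graph) (k : Fin (order K)) (l : Fin (order L)) (W : Graph) : Set where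
  field
    left            : Fin (order K) → Fin (order W)
    right           : Fin (order L) → Fin (order W)
    left-injective  : Injective _≡_ _≡_ left
    right-injective : Injective _≡_ _≡_ right
    meet            : ∀ x y → left x ≡ right y ⇔ (x ≡ k × y ≡ l)
    vertex-union    : ∀ z → (∃ λ x → z ≡ left x) ⊎ (∃ λ y → z ≡ right y)
    edge-union      : ∀ z z′ → Edge W z z′ ⇔
                        ((∃₂ λ x x′ → Edge K x x′ × z ≡ left x × z′ ≡ left x′) ⊎
                         (∃₂ λ y y′ → Edge L y y′ × z ≡ right y × z′ ≡ right y′))

data IteratedWedge : (m : ℕ) → (Fin (suc m) → Graph) → Graph → Set₁ where
  base : ∀ {G} → IteratedWedge 0 G (G zero)
  step : ∀ {m G V W} → IteratedWedge m (G ∘ inject₁) V →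
         (v : Fin (order V)) (g : Fin (order (G (fromℕ (suc m))))) →
         IsWedge V (G (fromℕ (suc m))) v g W →
         IteratedWedge (suc m) G W

{-# OPTIONS --safe #-}

-- A strong collapse inside a graph only ever removes leaves, so a strongly
-- collapsible subcomplex of a graph is a tree, and gscat G + 1 is the least
-- number of subtrees covering G.  In a wedge, a tree with vertices on both sides
-- passes through the wedge point, so it meets each side in a tree: covers of the
-- wedge restrict to covers of the two sides.  Conversely, since the sides are
-- connected, every subtree extends to one containing the wedge point, and the
-- i-th tree on one side is glued to the i-th tree on the other.

module Submission where

open import Defs
open import Data.Fin.Base using (Fin; zero; suc; inject₁)
import Data.Fin.Properties as Fin
open import Data.Fin.Relation.Unary.Top using (view; ‵fromℕ; ‵inject₁)
open import Data.Fin.Subset as Subset using (Subset; ⁅_⁆; _∈_)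
open import Data.Fin.Subset.Properties
  using (x∈⁅x⁆; x∈⁅y⁆⇒x≡y; x∈p∪q⁻; x∈p∪q⁺; ∪-comm; _∈?_; ⊆-antisym)
open import Data.List.Base using (tabulate)
open import Data.List.Extrema.Nat using (max; max≤v⁺; xs≤max)
open import Data.List.Relation.Unary.All.Properties using (tabulate⁺; tabulate⁻)
open import Data.Nat.Base using (ℕ; suc; _≤_; _≤′_; ≤′-refl; ≤′-step; z≤n)
open import Data.Nat.Properties using (≤⇒≤′; ≤-antisym)
open import Data.Product.Base using (∃; _×_; _,_; proj₁; proj₂)
open import Data.Product.Properties using (≡-dec)
open import Data.Sum.Base as Sum using (_⊎_; inj₁; inj₂; [_,_]′)
open import Function.Base using (_∘_; case_of_)
open import Function.Bundles using (_⇔_; mk⇔; Equivalence)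
open import Function.Definitions using (Injective)
open import Level using (0ℓ)
open import Relation.Binary.Construct.Closure.ReflexiveTransitive
  using (Star; ε; _◅_; _◅◅_; gmap; reverse)
open import Relation.Binary.PropositionalEquality
  using (_≡_; _≢_; refl; sym; trans; subst; cong; cong₂)
open import Relation.Nullary
  using (¬_; Dec; yes; no; contradiction; _×-dec_; _⊎-dec_; _→-dec_; ¬?)
open import Relation.Nullary.Decidable using (map′; decidable-stable)
open import Relation.Unary using (Pred; Decidable; _⊆_; _≐_; _∪_; ∅; ｛_｝)
open import Relation.Unary.Properties using (≐-refl; ≐-sym; ≐-trans)

open Equivalence using (to; from)

private
  variable
    n n′ m : ℕ

-- Trees grown by attaching leaves: decidability, grafting, change of root.

Link : Fin n → Fin n → Pred (Fin n × Fin n) 0ℓ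
Link u v = ｛ u , v ｝ ∪ ｛ v , u ｝

-- A tree is grown from a root by attaching leaves.  The constructors accept any
-- sets extensionally equal to the right ones, because a strong collapse
-- produces its vertex and edge sets only up to ≐.

data Tree {n} (r : Fin n) (V : Pred (Fin n) 0ℓ) (E : Pred (Fin n × Fin n) 0ℓ) : Set₁ where
  root : V ≐ ｛ r ｝ → E ≐ ∅ → Tree r V E
  grow : ∀ {V′ E′ u v} → Tree r V′ E′ → V′ u → ¬ V′ v →
         V ≐ V′ ∪ ｛ v ｝ → E ≐ E′ ∪ Link u v → Tree r V E

private
  variable
    r r′ k : Fin n
    V V₁ V₂ : Pred (Fin n) 0ℓ
    E E₁ E₂ : Pred (Fin n × Fin n) 0ℓ

tree-resp : V₁ ≐ V₂ → E₁ ≐ E₂ → Tree r V₁ E₁ → Tree r V₂ E₂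
tree-resp V≐ E≐ (root p q) = root (≐-trans (≐-sym V≐) p) (≐-trans (≐-sym E≐) q)
tree-resp V≐ E≐ (grow t u∈ v∉ p q) =
  grow t u∈ v∉ (≐-trans (≐-sym V≐) p) (≐-trans (≐-sym E≐) q)

root∈ : Tree r V E → V r
root∈ (root p q)         = proj₂ p refl
root∈ (grow t u∈ v∉ p q) = proj₂ p (inj₁ (root∈ t))

-- `V` is an arbitrary predicate, but a tree is a finite record of how its vertices were added, and
-- this makes membership decidable. `span` and `extend` rely on it.
vertex? : Tree r V E → Decidable V
vertex? (root p q) x = map′ (proj₂ p) (proj₁ p) (_ Fin.≟ x)
vertex? (grow t u∈ v∉ p q) x = map′ (proj₂ p) (proj₁ p) (vertex? t x ⊎-dec (_ Fin.≟ x))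

edge? : Tree r V E → Decidable E
edge? (root p q) e = no (proj₁ q)
edge? (grow t u∈ v∉ p q) e = map′ (proj₂ q) (proj₁ q)
  (edge? t e ⊎-dec (≡-dec Fin._≟_ Fin._≟_ _ e ⊎-dec ≡-dec Fin._≟_ Fin._≟_ _ e))

edge-sym : Tree r V E → ∀ {x y} → E (x , y) → E (y , x)
edge-sym (root p q) e = contradiction (proj₁ q e) λ ()
edge-sym (grow t u∈ v∉ p q) e with proj₁ q e
... | inj₁ e′          = proj₂ q (inj₁ (edge-sym t e′))
... | inj₂ (inj₁ refl) = proj₂ q (inj₂ (inj₂ refl))
... | inj₂ (inj₂ refl) = proj₂ q (inj₂ (inj₁ refl))

edge-source : Tree r V E → ∀ {x y} → E (x , y) → V x
edge-source (root p q) e = contradiction (proj₁ q e) λ ()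
edge-source (grow t u∈ v∉ p q) e with proj₁ q e
... | inj₁ e′          = proj₂ p (inj₁ (edge-source t e′))
... | inj₂ (inj₁ refl) = proj₂ p (inj₁ u∈)
... | inj₂ (inj₂ refl) = proj₂ p (inj₂ refl)

edge-irr : Tree r V E → ∀ {x} → ¬ E (x , x)
edge-irr (root p q) e = proj₁ q e
edge-irr (grow t u∈ v∉ p q) e with proj₁ q e
... | inj₁ e′          = edge-irr t e′
... | inj₂ (inj₁ refl) = v∉ u∈
... | inj₂ (inj₂ refl) = v∉ u∈

-- The leaves of the second tree are attached to the first in the order in which they grew, starting
-- from the shared root `r′`.
graft : Tree r V₁ E₁ → Tree r′ V₂ E₂ → V₁ r′ → (∀ {x} → V₁ x → V₂ x → x ≡ r′) →
        Tree r (V₁ ∪ V₂) (E₁ ∪ E₂)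
graft {V₁ = V₁} t (root p q) s∈ _ = tree-resp
  (inj₁ , [ (λ x∈ → x∈) , (λ x∈ → subst V₁ (proj₁ p x∈) s∈) ]′)
  (inj₁ , [ (λ e → e) , (λ e → contradiction (proj₁ q e) λ ()) ]′)
  t
graft t (grow {V′} {u = u} {v = v} t′ u∈ v∉ p q) s∈ meet = grow
  (graft t t′ s∈ (λ x∈ x∈′ → meet x∈ (proj₂ p (inj₁ x∈′))))
  (inj₂ u∈)
  -- If the new leaf lay in the first tree, `meet` would make it equal to `r′`, which is already in
  -- `V′`.
  [ (λ v∈ → v∉ (subst V′ (sym (meet v∈ (proj₂ p (inj₂ refl)))) (root∈ t′))) , v∉ ]′
  (split p) (split q)
  where
  split : ∀ {A : Set} {P Q R S : Pred A 0ℓ} → Q ≐ R ∪ S → P ∪ Q ≐ (P ∪ R) ∪ S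
  split (f , g) =
    (λ { (inj₁ x) → inj₁ (inj₁ x) ; (inj₂ y) → Sum.map₁ inj₂ (f y) }) ,
    (λ { (inj₁ (inj₁ x)) → inj₁ x
       ; (inj₁ (inj₂ y)) → inj₂ (g (inj₁ y))
       ; (inj₂ z)        → inj₂ (g (inj₂ z)) })

-- If `k` is older than the last leaf, the smaller tree is rerooted and the leaf attached again. If
-- `k` is the last leaf, growth starts with the edge from `k` to its parent, and the rest, rerooted
-- at the parent, is grafted on.
reroot : Tree r V E → V k → Tree k V E
reroot (root p q) k∈ with refl ← proj₁ p k∈ = root p q
reroot (grow {u = u} {v = v} t u∈ v∉ p q) k∈ with proj₁ p k∈
... | inj₁ k∈′ = grow (reroot t k∈′) u∈ v∉ p q
... | inj₂ refl = tree-resp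
  ( [ [ (λ { refl → proj₂ p (inj₂ refl) }) , (λ { refl → proj₂ p (inj₁ u∈) }) ]′
    , proj₂ p ∘ inj₁ ]′
  , (λ x∈ → [ inj₂ , inj₁ ∘ inj₁ ]′ (proj₁ p x∈)))
  ( [ [ (λ ()) , proj₂ q ∘ inj₂ ∘ Sum.swap ]′ , proj₂ q ∘ inj₁ ]′
  , (λ e → [ inj₂ , inj₁ ∘ inj₂ ∘ Sum.swap ]′ (proj₁ q e)))
  (graft (grow (root {V = ｛ v ｝} {E = ∅} ≐-refl ≐-refl) refl v≢u ≐-refl ≐-refl)
         (reroot t u∈) (inj₂ refl)
         λ { (inj₁ refl) x∈ → contradiction x∈ v∉ ; (inj₂ refl) _ → refl })
  where
  v≢u : v ≢ u
  v≢u refl = v∉ u∈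

-- Images and preimages of trees under injections.

Image : {A B : Set} → (A → B) → Pred A 0ℓ → Pred B 0ℓ
Image f P y = ∃ λ x → P x × f x ≡ y

map₂ : (Fin n → Fin n′) → Fin n × Fin n → Fin n′ × Fin n′
map₂ f (x , y) = f x , f y

tree-image : {f : Fin n → Fin n′} → Injective _≡_ _≡_ f →
             Tree r V E → Tree (f r) (Image f V) (Image (map₂ f) E)
tree-image inj (root p q) = root
  ( (λ { (x , x∈ , refl) → cong _ (proj₁ p x∈) })
  , (λ { refl → _ , proj₂ p refl , refl }))
  ( (λ { (_ , e , _) → proj₁ q e }) , λ ())
tree-image {f = f} inj (grow {V′ = V′} t u∈ v∉ p q) = grow (tree-image inj t)
  (_ , u∈ , refl)
  (λ (x , x∈ , fx≡fv) → v∉ (subst V′ (inj fx≡fv) x∈))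
  ( (λ { (x , x∈ , refl) → case proj₁ p x∈ of λ
           { (inj₁ x∈′) → inj₁ (x , x∈′ , refl) ; (inj₂ refl) → inj₂ refl } })
  , (λ { (inj₁ (x , x∈ , refl)) → x , proj₂ p (inj₁ x∈) , refl
       ; (inj₂ refl) → _ , proj₂ p (inj₂ refl) , refl }))
  ( (λ { (x , e , refl) → case proj₁ q e of λ
           { (inj₁ e′) → inj₁ (x , e′ , refl)
           ; (inj₂ (inj₁ refl)) → inj₂ (inj₁ refl)
           ; (inj₂ (inj₂ refl)) → inj₂ (inj₂ refl) } })
  , (λ { (inj₁ (x , e , refl)) → x , proj₂ q (inj₁ e) , refl
       ; (inj₂ (inj₁ refl)) → _ , proj₂ q (inj₂ (inj₁ refl)) , refl
       ; (inj₂ (inj₂ refl)) → _ , proj₂ q (inj₂ (inj₂ refl)) , refl }))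

-- The last component carries the induction: when a new leaf lies in the image
-- and its parent does not, the leaf is f c, and as f c was not yet in the tree,
-- nothing of the image was.

tree-preimage : {f : Fin n → Fin n′} → Injective _≡_ _≡_ f → (c : Fin n) →
  Tree r V E →
  (∀ {x z} → E (f x , z) → (∀ y → f y ≢ z) → x ≡ c) →
  (∀ x → ¬ V (f x)) ⊎
  (∃ λ s → Tree s (V ∘ f) (E ∘ map₂ f)) × (∀ {z} → V z → (∀ y → f y ≢ z) → V (f c))
tree-preimage {r = r} {f = f} inj c (root p q) _ with Fin.any? (λ x → f x Fin.≟ r)
... | yes (x , refl) = inj₂
  ( (x , root ((λ y∈ → inj (proj₁ p y∈)) , λ { refl → proj₂ p refl })
              ((λ e → proj₁ q e) , λ ()))
  , (λ z∈ out → contradiction (proj₁ p z∈) (out x)))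
... | no out = inj₁ λ x x∈ → out (x , sym (proj₁ p x∈))
tree-preimage {V = V} {E = E} {f = f} inj c (grow {V′ = V′} {E′} {u} {v} t u∈ v∉ p q) cut
  with Fin.any? (λ x → f x Fin.≟ v) | Fin.any? (λ x → f x Fin.≟ u)
     | tree-preimage inj c t (λ e → cut (proj₂ q (inj₁ e)))
... | no v-out | _ | inj₁ none = inj₁ λ x x∈ →
      [ none x , (λ v≡ → v-out (x , sym v≡)) ]′ (proj₁ p x∈)
... | no v-out | u-in | inj₂ ((s , t′) , through) = inj₂
      ( (s , tree-resp
          ( (λ x∈ → proj₂ p (inj₁ x∈))
          , (λ {x} x∈ → [ (λ x∈′ → x∈′) , (λ v≡ → contradiction (x , sym v≡) v-out) ]′ (proj₁ p x∈)))
          ( (λ e → proj₂ q (inj₁ e))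
          , (λ {e} e∈ → [ (λ e∈′ → e∈′) , (λ l → contradiction l (no-link e)) ]′ (proj₁ q e∈)))
          t′)
      , (λ {z} z∈ out → proj₂ p (inj₁ (
          [ (λ z∈′ → through z∈′ out) , (λ _ → fc∈ u-in) ]′ (proj₁ p z∈)))))
  where
  no-link : ∀ e → ¬ Link u v (map₂ f e)
  no-link (x , y) (inj₁ eq) = v-out (y , sym (cong proj₂ eq))
  no-link (x , y) (inj₂ eq) = v-out (x , sym (cong proj₁ eq))

  fc∈ : Dec (∃ λ x → f x ≡ u) → V′ (f c)
  fc∈ (no u-out) = through u∈ (λ y eq → u-out (y , eq))
  -- The new edge leaves the image at the parent, so `cut` makes the parent `f c`.
  fc∈ (yes (x , refl)) =
    subst (V′ ∘ f) (cut (proj₂ q (inj₂ (inj₁ refl))) (λ y eq → v-out (y , eq))) u∈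
... | yes (y , refl) | yes (x , refl) | inj₁ none = contradiction u∈ (none x)
... | yes (y , refl) | yes (x , refl) | inj₂ ((s , t′) , through) = inj₂
      ( (s , grow t′ u∈ v∉
          ( (λ x∈ → Sum.map₂ inj (proj₁ p x∈))
          , (λ x∈ → proj₂ p (Sum.map₂ (cong f) x∈)))
          ( (λ e → Sum.map₂ (Sum.map inj₂′ inj₂′) (proj₁ q e))
          , (λ e → proj₂ q (Sum.map₂ (Sum.map (cong (map₂ f)) (cong (map₂ f))) e))))
      , (λ z∈ out → proj₂ p (inj₁ (
          [ (λ z∈′ → through z∈′ out) , (λ v≡ → contradiction v≡ (out y)) ]′ (proj₁ p z∈)))))
  where
  inj₂′ : ∀ {a b} → map₂ f a ≡ map₂ f b → a ≡ b
  inj₂′ eq = cong₂ _,_ (inj (cong proj₁ eq)) (inj (cong proj₂ eq))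
... | yes (y , refl) | no u-out | ih
  with refl ← cut {y} {u} (proj₂ q (inj₂ (inj₂ refl))) (λ y eq → u-out (y , eq))
  with ih
... | inj₂ (_ , through) = contradiction (through u∈ λ y eq → u-out (y , eq)) v∉
... | inj₁ none = inj₂
      ( (c , root
          ( (λ {x} x∈ → [ (λ x∈′ → contradiction x∈′ (none x)) , inj ]′ (proj₁ p x∈))
          , (λ { refl → proj₂ p (inj₂ refl) }))
          ( (λ {e} e∈ → no-edge e (proj₁ q e∈)) , λ ()))
      , (λ _ _ → proj₂ p (inj₂ refl)))
  where
  no-edge : ∀ e → ¬ (E′ ∪ Link u (f c)) (map₂ f e)
  no-edge (x , y) (inj₁ e)         = none x (edge-source t e)
  no-edge (x , y) (inj₂ (inj₁ eq)) = u-out (x , sym (cong proj₁ eq))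
  no-edge (x , y) (inj₂ (inj₂ eq)) = u-out (y , sym (cong proj₂ eq))

-- Simplices of a graph as singletons and pairs.

private
  variable
    s : Subset n
    a b c x y : Fin n

pair : Fin n → Fin n → Subset n
pair a b = ⁅ a ⁆ Subset.∪ ⁅ b ⁆

∈-pairˡ : a ∈ pair a b
∈-pairˡ {a = a} = x∈p∪q⁺ (inj₁ (x∈⁅x⁆ a))

∈-pairʳ : b ∈ pair a b
∈-pairʳ {b = b} = x∈p∪q⁺ (inj₂ (x∈⁅x⁆ b))

∈-pair⁻ : x ∈ pair a b → x ≡ a ⊎ x ≡ b
∈-pair⁻ {a = a} {b = b} x∈ = Sum.map (x∈⁅y⁆⇒x≡y a) (x∈⁅y⁆⇒x≡y b) (x∈p∪q⁻ _ _ x∈)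

singleton-⊆ : a ∈ s → ⁅ a ⁆ Subset.⊆ s
singleton-⊆ {a = a} {s = s} a∈s x∈ = subst (_∈ s) (sym (x∈⁅y⁆⇒x≡y a x∈)) a∈s

singleton-injective : ⁅ a ⁆ ≡ ⁅ b ⁆ → a ≡ b
singleton-injective {a = a} {b = b} eq = x∈⁅y⁆⇒x≡y b (subst (a ∈_) eq (x∈⁅x⁆ a))

singleton≢pair : a ≢ b → ⁅ c ⁆ ≢ pair a b
singleton≢pair {c = c} a≢b eq = a≢b (trans (at ∈-pairˡ) (sym (at ∈-pairʳ)))
  where
  at : x ∈ pair _ _ → x ≡ c
  at {x} x∈ = x∈⁅y⁆⇒x≡y c (subst (x ∈_) (sym eq) x∈)

module _ (G : Graph) where

  open Graph G using (_—_; —-sym)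

  simplex-pair : Simplex (complex G) s → a ∈ s → b ∈ s → a ≢ b → s ≡ pair a b
  simplex-pair (inj₁ (v , refl)) a∈ b∈ a≢b =
    contradiction (trans (x∈⁅y⁆⇒x≡y v a∈) (sym (x∈⁅y⁆⇒x≡y v b∈))) a≢b
  simplex-pair (inj₂ (u , v , _ , refl)) a∈ b∈ a≢b with ∈-pair⁻ a∈ | ∈-pair⁻ b∈
  ... | inj₁ refl | inj₁ refl = contradiction refl a≢b
  ... | inj₁ refl | inj₂ refl = refl
  ... | inj₂ refl | inj₁ refl = ∪-comm ⁅ u ⁆ ⁅ v ⁆
  ... | inj₂ refl | inj₂ refl = contradiction refl a≢b

  simplex-star : Simplex (complex G) s → a ∈ s →
                 s ≡ ⁅ a ⁆ ⊎ (∃ λ b → b ≢ a × s ≡ pair a b)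
  simplex-star {s = s} {a = a} s∈ a∈ with Fin.any? (λ b → (b ∈? s) ×-dec ¬? (b Fin.≟ a))
  ... | yes (b , b∈ , b≢a) = inj₂ (b , b≢a , simplex-pair s∈ a∈ b∈ (b≢a ∘ sym))
  ... | no ¬∃ = inj₁ (⊆-antisym
        (λ {x} x∈ → subst (_∈ ⁅ a ⁆)
          (sym (decidable-stable (x Fin.≟ a) λ x≢a → ¬∃ (x , x∈ , x≢a))) (x∈⁅x⁆ a))
        (singleton-⊆ a∈))

  pair-edge : a ≢ b → Simplex (complex G) (pair a b) → a — b
  pair-edge a≢b (inj₁ (v , eq)) = contradiction (sym eq) (singleton≢pair a≢b)
  pair-edge {a = a} {b = b} a≢b (inj₂ (u , v , e , eq))
    with ∈-pair⁻ (subst (a ∈_) eq ∈-pairˡ) | ∈-pair⁻ (subst (b ∈_) eq (∈-pairʳ {a = a}))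
  ... | inj₁ refl | inj₁ refl = contradiction refl a≢b
  ... | inj₁ refl | inj₂ refl = e
  ... | inj₂ refl | inj₁ refl = —-sym e
  ... | inj₂ refl | inj₂ refl = contradiction refl a≢b

-- Without x ≢ y every vertex would give a loop, since pair x x ≡ ⁅ x ⁆.

Edges : Complex n → Pred (Fin n × Fin n) 0ℓ
Edges K (x , y) = x ≢ y × Simplex K (pair x y)

-- Strongly collapsible subcomplexes of a graph are trees, and conversely.

module _ (G : Graph) where

  private
    variable
      K : Complex (order G)
      u v : Fin (order G)

  simplex-link : Simplex K ⊆ Simplex (complex G) → Simplex K s → a ∈ s →
    s ≡ ⁅ a ⁆ ⊎ (∃ λ b → Edges K (a , b) × s ≡ pair a b)
  simplex-link {K = K} K⊆G s∈ a∈ with simplex-star G (K⊆G s∈) a∈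
  ... | inj₁ eq             = inj₁ eq
  ... | inj₂ (b , b≢a , eq) = inj₂ (b , (b≢a ∘ sym , subst (Simplex K) eq s∈) , eq)

  pair-maximal : Simplex K ⊆ Simplex (complex G) → Edges K (a , b) → Maximal K (pair a b)
  pair-maximal K⊆G (a≢b , ab∈) = ab∈ , λ t t∈ ab⊆t →
    simplex-pair G (K⊆G t∈) (ab⊆t ∈-pairˡ) (ab⊆t ∈-pairʳ) a≢b

  -- In dimension at most one every edge is a maximal simplex, so each edge at `v` has to contain
  -- the dominating vertex `u`.
  dominated⇒leaf : Simplex K ⊆ Simplex (complex G) → Dominated K v u →
    Edges K (v , u) × (∀ {x} → Edges K (v , x) → x ≡ u)
  dominated⇒leaf {K = K} {v = v} {u = u} K⊆G (dominated u≢v v∈K u∈K dom) =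
    (u≢v ∘ sym , vu∈K) , only
    where
    only : ∀ {x} → Edges K (v , x) → x ≡ u
    only e with ∈-pair⁻ (dom _ (pair-maximal {K = K} K⊆G e) ∈-pairˡ)
    ... | inj₁ u≡v = contradiction u≡v u≢v
    ... | inj₂ u≡x = sym u≡x

    vu∈K : Simplex K (pair v u)
    -- Were the pair missing, `only` would leave `v` without edges. Then `⁅ v ⁆` would be maximal,
    -- and domination would put `u` in it.
    vu∈K = decidable-stable (simplex? K (pair v u)) λ vu∉K →
      u≢v (x∈⁅y⁆⇒x≡y v (dom ⁅ v ⁆ (v∈K , λ t t∈K v⊆t →
        [ (λ eq → eq)
        , (λ (x , e , _) → contradiction
            (subst (λ y → Simplex K (pair v y)) (only e) (proj₂ e)) vu∉K)
        ]′ (simplex-link {K = K} K⊆G t∈K (v⊆t (x∈⁅x⁆ v)))) (x∈⁅x⁆ v)))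

  -- The collapse is read backwards: the final vertex is the root, and each deleted vertex returns
  -- as a leaf attached to the vertex that dominated it.
  collapsible⇒tree : Simplex K ⊆ Simplex (complex G) → StronglyCollapsible K →
                     ∃ λ r → Tree r (Vertex K) (Edges K)
  collapsible⇒tree K⊆G (_ , ε , v , f , g) = v , root
    ((λ x∈ → singleton-injective (f x∈)) , λ { refl → g refl })
    ((λ (x≢y , xy∈) → singleton≢pair x≢y (f xy∈)) , λ ())
  collapsible⇒tree {K = K} K⊆G (L , collapse {v} {u} d ◅ ds , pt)
    with r , t ← collapsible⇒tree {K = K ∖ v} (λ s∈ → K⊆G (proj₁ s∈)) (L , ds , pt)
       | (v≢u , vu∈K) , only ← dominated⇒leaf {K = K} K⊆G d
    = r , grow t
      (Dominated.vertexᵘ d , λ v∈u → v≢u (x∈⁅y⁆⇒x≡y u v∈u))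
      (λ (_ , v∉v) → v∉v (x∈⁅x⁆ v))
      (split-vertex , [ proj₁ , (λ { refl → Dominated.vertexᵛ d }) ]′)
      (split-edge , [ (λ (x≢y , xy∈ , _) → x≢y , xy∈)
                    , [ (λ { refl → v≢u ∘ sym , flip-pair vu∈K })
                      , (λ { refl → v≢u , vu∈K }) ]′ ]′)
    where
    flip-pair : ∀ {x y} → Simplex K (pair x y) → Simplex K (pair y x)
    flip-pair {x} {y} = subst (Simplex K) (∪-comm ⁅ x ⁆ ⁅ y ⁆)

    split-vertex : Vertex K ⊆ Vertex (K ∖ v) ∪ ｛ v ｝
    split-vertex {x} x∈ with v Fin.≟ x
    ... | yes v≡x = inj₂ v≡x
    ... | no v≢x  = inj₁ (x∈ , λ v∈x → v≢x (x∈⁅y⁆⇒x≡y x v∈x))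

    split-edge : Edges K ⊆ Edges (K ∖ v) ∪ Link u v
    split-edge {x , y} (x≢y , xy∈) with v Fin.≟ x | v Fin.≟ y
    ... | yes refl | _ with refl ← only (x≢y , xy∈) = inj₂ (inj₂ refl)
    ... | no _ | yes refl with refl ← only (x≢y ∘ sym , flip-pair xy∈) = inj₂ (inj₁ refl)
    ... | no v≢x | no v≢y = inj₁ (x≢y , xy∈ , λ v∈ → [ v≢x , v≢y ]′ (∈-pair⁻ v∈))

  -- Leaves are deleted in the reverse order of growth, each dominated by its parent. `K` is any
  -- complex with the given vertices and edges, so that the induction can pass to `K ∖ v`.
  tree⇒collapsible : Simplex K ⊆ Simplex (complex G) → Vertex K ≐ V → Edges K ≐ E →
                     Tree r V E → StronglyCollapsible K
  tree⇒collapsible {K = K} {r = r} K⊆G V≐ E≐ (root p q) =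
    K , ε , r , (λ {s} → only-root s) , λ { refl → proj₂ V≐ (proj₂ p refl) }
    where
    only-root : ∀ s → Simplex K s → ⁅ r ⁆ ≡ s
    only-root s s∈
      with a , a∈ ← nonempty K s∈
      with refl ← proj₁ p (proj₁ V≐ (down-closed K s∈ (a , x∈⁅x⁆ a) (singleton-⊆ a∈)))
      with simplex-link {K = K} K⊆G s∈ a∈
    ... | inj₁ eq          = sym eq
    ... | inj₂ (b , e , _) = contradiction (proj₁ q (proj₁ E≐ e)) λ ()
  tree⇒collapsible {K = K} K⊆G V≐ E≐ (grow {V′} {E′} {u} {v} t u∈ v∉ p q)
    with tree⇒collapsible {K = K ∖ v} (λ s∈ → K⊆G (proj₁ s∈)) vertices edges t
    where
    vertices : Vertex (K ∖ v) ≐ V′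
    vertices =
      (λ {x} (x∈ , v∉x) → [ (λ x∈′ → x∈′) , (λ { refl → contradiction (x∈⁅x⁆ x) v∉x }) ]′
                            (proj₁ p (proj₁ V≐ x∈))) ,
      (λ {x} x∈ → proj₂ V≐ (proj₂ p (inj₁ x∈)) ,
                  λ v∈x → v∉ (subst V′ (sym (x∈⁅y⁆⇒x≡y x v∈x)) x∈))

    edges : Edges (K ∖ v) ≐ E′
    edges =
      (λ { (x≢y , xy∈ , v∉xy) → case proj₁ q (proj₁ E≐ (x≢y , xy∈)) of λ
             { (inj₁ e)           → e
             ; (inj₂ (inj₁ refl)) → contradiction (∈-pairʳ {a = u}) v∉xy
             ; (inj₂ (inj₂ refl)) → contradiction ∈-pairˡ v∉xy } }) ,
      (λ e → let x≢y , xy∈ = proj₂ E≐ (proj₂ q (inj₁ e)) in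
             x≢y , xy∈ , λ v∈ → [ (λ { refl → v∉ (edge-source t e) })
                                , (λ { refl → v∉ (edge-source t (edge-sym t e)) }) ]′ (∈-pair⁻ v∈))
  ... | L , ds , pt = L , collapse (dominated u≢v
          (proj₂ V≐ (proj₂ p (inj₂ refl))) (proj₂ V≐ (proj₂ p (inj₁ u∈))) dominates) ◅ ds , pt
    where
    u≢v : u ≢ v
    u≢v refl = v∉ u∈

    vu∈K : Simplex K (pair v u)
    vu∈K = proj₂ (proj₂ E≐ (proj₂ q (inj₂ (inj₂ refl))))

    dominates : ∀ s → Maximal K s → v ∈ s → u ∈ s
    dominates s (s∈ , max) v∈ with simplex-link {K = K} K⊆G s∈ v∈
    -- Maximality identifies `⁅ v ⁆` with the edge from `v` to `u`, which contains `u`.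
    ... | inj₁ refl = subst (u ∈_) (max _ vu∈K (singleton-⊆ ∈-pairˡ)) (∈-pairʳ {a = v})
    ... | inj₂ (b , e , refl) with proj₁ q (proj₁ E≐ e)
    ...   | inj₁ e′          = contradiction (edge-source t e′) v∉
    ...   | inj₂ (inj₁ refl) = contradiction refl u≢v
    ...   | inj₂ (inj₂ refl) = ∈-pairʳ {a = v}

-- Subtrees, and covers of a graph by them.

-- Every element of `Fin (order G)` is a vertex of `G`, so lying in `G` is a condition on edges
-- alone.
record Subtree (G : Graph) (r : Fin (order G)) : Set₁ where
  constructor subtree
  field
    {vertex} : Pred (Fin (order G)) 0ℓ
    {edge}   : Pred (Fin (order G) × Fin (order G)) 0ℓ
    tree     : Tree r vertex edge
    edge⊆    : ∀ {x y} → edge (x , y) → Edge G x y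

record TreeCover (G : Graph) (m : ℕ) : Set₁ where
  field
    part     : Fin (suc m) → ∃ (Subtree G)
    vertices : ∀ x → ∃ λ i → Subtree.vertex (proj₂ (part i)) x
    edges    : ∀ {x y} → Edge G x y → ∃ λ i → Subtree.edge (proj₂ (part i)) (x , y)

module _ {G : Graph} where

  module _ (T : Subtree G r) where
    open Subtree T

    -- Both conditions quantify over the elements of `s`, so they pass to subsets at once and are
    -- decided by finite search.
    span : Complex (order G)
    span = record
      { Simplex     = λ s → Simplex (complex G) s × (∀ x → x ∈ s → vertex x) ×
                            (∀ x y → x ∈ s → y ∈ s → x ≢ y → edge (x , y))
      ; simplex?    = λ s → simplex? (complex G) s ×-dec
          Fin.all? (λ x → (x ∈? s) →-dec vertex? tree x) ×-dec
          Fin.all? (λ x → Fin.all? λ y →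
            (x ∈? s) →-dec (y ∈? s) →-dec ¬? (x Fin.≟ y) →-dec edge? tree (x , y))
      ; nonempty    = nonempty (complex G) ∘ proj₁
      ; down-closed = λ (s∈ , V⊇ , E⊇) t≠∅ t⊆s → down-closed (complex G) s∈ t≠∅ t⊆s ,
          (λ x x∈ → V⊇ x (t⊆s x∈)) , (λ x y x∈ y∈ → E⊇ x y (t⊆s x∈) (t⊆s y∈))
      }

    vertex⇒span : vertex x → Vertex span x
    vertex⇒span {x} x∈ = inj₁ (x , refl) ,
      (λ y y∈ → subst vertex (sym (x∈⁅y⁆⇒x≡y x y∈)) x∈) ,
      (λ y z y∈ z∈ y≢z →
        contradiction (trans (x∈⁅y⁆⇒x≡y x y∈) (sym (x∈⁅y⁆⇒x≡y x z∈))) y≢z)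

    edge⇒span : edge (x , y) → Simplex span (pair x y)
    edge⇒span {x} {y} e = inj₂ (x , y , edge⊆ e , refl) ,
      (λ z z∈ → case ∈-pair⁻ z∈ of λ
        { (inj₁ refl) → edge-source tree e
        ; (inj₂ refl) → edge-source tree (edge-sym tree e) }) ,
      (λ a b a∈ b∈ a≢b → case ∈-pair⁻ a∈ , ∈-pair⁻ b∈ of λ
        { (inj₁ refl , inj₁ refl) → contradiction refl a≢b
        ; (inj₁ refl , inj₂ refl) → e
        ; (inj₂ refl , inj₁ refl) → edge-sym tree e
        ; (inj₂ refl , inj₂ refl) → contradiction refl a≢b })

    span-collapsible : StronglyCollapsible span
    span-collapsible = tree⇒collapsible G {K = span} proj₁
      ((λ {x} (_ , V⊇ , _) → V⊇ x (x∈⁅x⁆ x)) , vertex⇒span)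
      ( (λ { {x , y} (x≢y , _ , _ , E⊇) → E⊇ x y ∈-pairˡ (∈-pairʳ {a = x}) x≢y })
      , (λ e → (λ { refl → edge-irr tree e }) , edge⇒span e))
      tree

  treeCover⇒cover : TreeCover G m → Cover (complex G) m
  treeCover⇒cover C = cover
    (λ i → span (proj₂ (part i)))
    (λ i → span-collapsible (proj₂ (part i)))
    ( (λ { (inj₁ (v , refl)) → let i , v∈ = vertices v in i , vertex⇒span (proj₂ (part i)) v∈
         ; (inj₂ (u , v , u—v , refl)) →
             let i , e = edges u—v in i , edge⇒span (proj₂ (part i)) e })
    , (λ (i , s∈) → proj₁ s∈))
    where open TreeCover C

  cover⇒treeCover : Cover (complex G) m → TreeCover G m
  cover⇒treeCover (cover C sc (f , g)) = record
    { part     = λ i →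
        let r , t = collapsible⇒tree G {K = C i} (λ s∈ → g (i , s∈)) (sc i) in
        r , subtree t (λ (x≢y , xy∈) → pair-edge G x≢y (g (i , xy∈)))
    ; vertices = λ x → f (inj₁ (x , refl))
    ; edges    = λ {x} {y} x—y → let i , xy∈ = f (inj₂ (x , y , x—y , refl)) in
        i , (λ { refl → Graph.—-irr G x—y }) , xy∈
    }

cover-suc : ∀ {G m} → TreeCover G m → TreeCover G (suc m)
cover-suc C = record
  -- Parts may overlap, so the extra part repeats part zero and the old parts shift by one.
  { part     = λ { zero → part zero ; (suc i) → part i }
  ; vertices = λ x → let i , x∈ = vertices x in suc i , x∈
  ; edges    = λ e → let i , e∈ = edges e in suc i , e∈
  }
  where open TreeCover C

-- Brings covers of different graphs to a common number of parts, as gluing them requires. With `≤′`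
-- the induction adds one part at a time.
cover-mono : ∀ {G m m′} → m ≤′ m′ → TreeCover G m → TreeCover G m′
cover-mono ≤′-refl        C = C
cover-mono (≤′-step m≤m′) C = cover-suc (cover-mono m≤m′ C)

-- Enlarging subtrees of a connected graph.

module _ {G : Graph} where

  open Subtree

  attach : ∀ {r u w} (T : Subtree G r) → vertex T u → ¬ vertex T w → Edge G u w → Subtree G r
  attach T u∈ w∉ u—w = subtree (grow (tree T) u∈ w∉ ≐-refl ≐-refl) λ
    { (inj₁ e)           → edge⊆ T e
    ; (inj₂ (inj₁ refl)) → u—w
    ; (inj₂ (inj₂ refl)) → Graph.—-sym G u—w }

  -- The path is followed from inside the tree. A vertex not yet in the tree becomes a leaf; a
  -- vertex already there is passed without adding an edge, so no cycle closes.
  extend : ∀ {r u k} → Star (Edge G) u k → (T : Subtree G r) → vertex T u →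
           ∃ λ (T′ : Subtree G r) →
             vertex T ⊆ vertex T′ × edge T ⊆ edge T′ × vertex T′ k
  extend ε T u∈ = T , (λ x∈ → x∈) , (λ e → e) , u∈
  extend (_◅_ {j = w} u—w path) T u∈ with vertex? (tree T) w
  ... | yes w∈ = extend path T w∈
  ... | no w∉
    with T′ , V⊆ , E⊆ , k∈ ← extend path (attach T u∈ w∉ u—w) (inj₂ refl)
    = T′ , V⊆ ∘ inj₁ , E⊆ ∘ inj₁ , k∈

  -- The tree is extended to reach `k` and then rerooted there, since `glue` takes trees rooted at
  -- the wedge vertices.
  through : Connected G → ∀ {r} → (T : Subtree G r) → ∀ k →
            ∃ λ (T′ : Subtree G k) → vertex T ⊆ vertex T′ × edge T ⊆ edge T′
  through connected {r} T k
    with T′ , V⊆ , E⊆ , k∈ ← extend (connected r k) T (root∈ (tree T))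
    = subtree (reroot (tree T′) k∈) (edge⊆ T′) , V⊆ , E⊆

-- Tree covers of a single wedge.

-- Carries results about the left side over to the right side.
swap : ∀ {K L k l W} → IsWedge K L k l W → IsWedge L K l k W
swap wedge = record
  { left            = right
  ; right           = left
  ; left-injective  = right-injective
  ; right-injective = left-injective
  ; meet            = λ x y → mk⇔
      (λ eq → let y≡ , x≡ = to (meet y x) (sym eq) in x≡ , y≡)
      (λ (x≡ , y≡) → sym (from (meet y x) (y≡ , x≡)))
  ; vertex-union    = Sum.swap ∘ vertex-union
  ; edge-union      = λ z z′ → mk⇔ (Sum.swap ∘ to (edge-union z z′))
                                   (from (edge-union z z′) ∘ Sum.swap)
  }
  where open IsWedge wedge

module _ {K L W : Graph} {k l} (wedge : IsWedge K L k l W) where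

  open IsWedge wedge

  joint : left k ≡ right l
  joint = from (meet k l) (refl , refl)

  left-edge⁺ : ∀ {x y} → Edge K x y → Edge W (left x) (left y)
  left-edge⁺ e = from (edge-union _ _) (inj₁ (_ , _ , e , refl , refl))

  right-edge⁺ : ∀ {x y} → Edge L x y → Edge W (right x) (right y)
  right-edge⁺ e = from (edge-union _ _) (inj₂ (_ , _ , e , refl , refl))

  left-edge⁻ : ∀ {x y} → Edge W (left x) (left y) → Edge K x y
  left-edge⁻ e with to (edge-union _ _) e
  ... | inj₁ (_ , _ , e′ , p , q)
    with refl ← left-injective p | refl ← left-injective q = e′
  -- Both ends lie on both sides, so both are `l` in `L` and `e′` would be a loop.
  ... | inj₂ (_ , _ , e′ , p , q)
    with _ , refl ← to (meet _ _) p | _ , refl ← to (meet _ _) q =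
    contradiction e′ (Graph.—-irr L)

  -- An edge leaving the left side comes from `L`, so its left end lies on both sides and is the
  -- wedge point. This is the cut condition of `tree-preimage`.
  left-exit : ∀ {x z} → Edge W (left x) z → (∀ y → left y ≢ z) → x ≡ k
  left-exit e out with to (edge-union _ _) e
  ... | inj₁ (_ , _ , _ , _ , refl) = contradiction refl (out _)
  ... | inj₂ (_ , _ , _ , p , _)    = proj₁ (to (meet _ _) p)

  wedge-connected : Connected K → Connected L → Connected W
  wedge-connected K-connected L-connected z z′ =
    reverse (Graph.—-sym W) (from-joint z) ◅◅ from-joint z′
    where
    from-joint : ∀ z → Star (Edge W) (left k) z
    from-joint z with vertex-union z
    ... | inj₁ (x , refl) = gmap left left-edge⁺ (K-connected k x)
    ... | inj₂ (y , refl) = subst (λ j → Star (Edge W) j (right y)) (sym joint)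
                                  (gmap right right-edge⁺ (L-connected l y))

  restrict : ∀ {r} (T : Subtree W r) → ∃ λ s → ∃ λ (T′ : Subtree K s) →
             (∀ {x} → Subtree.vertex T (left x) → Subtree.vertex T′ x) ×
             (∀ {x y} → Subtree.edge T (left x , left y) → Subtree.edge T′ (x , y))
  restrict T with tree-preimage left-injective k (Subtree.tree T) (left-exit ∘ Subtree.edge⊆ T)
  -- A tree that misses the left side restricts to nothing; the single vertex `k` takes its place,
  -- which keeps the number of parts.
  ... | inj₁ none = k , subtree (root ≐-refl ≐-refl) (λ ()) ,
        (λ {x} x∈ → contradiction x∈ (none x)) ,
        (λ {x} e → contradiction (edge-source (Subtree.tree T) e) (none x))
  ... | inj₂ ((s , t) , _) = s , subtree t (left-edge⁻ ∘ Subtree.edge⊆ T) ,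
        (λ x∈ → x∈) , (λ e → e)

  restrict-cover : ∀ {m} → TreeCover W m → TreeCover K m
  restrict-cover C = record
    { part     = λ i → let s , T , _ = restrict (proj₂ (part i)) in s , T
    ; vertices = λ x → let i , x∈ = vertices (left x) in
                       i , proj₁ (proj₂ (proj₂ (restrict (proj₂ (part i))))) x∈
    ; edges    = λ e → let i , e∈ = edges (left-edge⁺ e) in
                       i , proj₂ (proj₂ (proj₂ (restrict (proj₂ (part i))))) e∈
    }
    where open TreeCover C

  -- The two images meet only in the wedge point, which is the root of the second image, so `graft`
  -- applies.
  glue : Subtree K k → Subtree L l → Subtree W (left k)
  glue S T = subtree
    (graft (tree-image left-injective (Subtree.tree S))
           (tree-image right-injective (Subtree.tree T))
           (k , root∈ (Subtree.tree S) , joint)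
           λ { (x , _ , refl) (y , _ , eq) →
               trans (cong left (proj₁ (to (meet x y) (sym eq)))) joint })
    λ { (inj₁ (_ , e , refl)) → left-edge⁺ (Subtree.edge⊆ S e)
      ; (inj₂ (_ , e , refl)) → right-edge⁺ (Subtree.edge⊆ T e) }

  -- Every vertex and edge of `W` comes from one side, and there the parts enlarged by `through`
  -- still cover. Pairing equal indices keeps the number of parts.
  glue-cover : Connected K → Connected L →
               ∀ {m} → TreeCover K m → TreeCover L m → TreeCover W m
  glue-cover K-connected L-connected C D = record
    { part     = λ i → _ , glue (proj₁ (S i)) (proj₁ (T i))
    ; vertices = λ z → case vertex-union z of λ
        { (inj₁ (x , refl)) → let i , x∈ = vertices C x in
            i , inj₁ (x , proj₁ (proj₂ (S i)) x∈ , refl)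
        ; (inj₂ (y , refl)) → let i , y∈ = vertices D y in
            i , inj₂ (y , proj₁ (proj₂ (T i)) y∈ , refl) }
    ; edges    = λ e → case to (edge-union _ _) e of λ
        { (inj₁ (_ , _ , e′ , refl , refl)) → let i , e∈ = edges C e′ in
            i , inj₁ (_ , proj₂ (proj₂ (S i)) e∈ , refl)
        ; (inj₂ (_ , _ , e′ , refl , refl)) → let i , e∈ = edges D e′ in
            i , inj₂ (_ , proj₂ (proj₂ (T i)) e∈ , refl) }
    }
    where
    open TreeCover
    S = λ i → through K-connected (proj₂ (part C i)) k
    T = λ i → through L-connected (proj₂ (part D i)) l

-- Iterated wedges and the maximum formula.

iterated-connected : ∀ {m G W} → (∀ i → Connected (G i)) → IteratedWedge m G W → Connected W
iterated-connected conn base             = conn zero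
iterated-connected conn (step w v g wedge) =
  wedge-connected wedge (iterated-connected (conn ∘ inject₁) w) (conn _)

-- With the number of parts fixed, the equivalence passes through each wedge without arithmetic; the
-- maximum enters only in the final theorem.
iterated-cover : ∀ {m G W} → (∀ i → Connected (G i)) → IteratedWedge m G W →
                 ∀ {j} → TreeCover W j ⇔ (∀ i → TreeCover (G i) j)
iterated-cover conn base = mk⇔ (λ { C zero → C }) (λ C → C zero)
iterated-cover {G = G} {W} conn (step {m} {V = V} w v g wedge) {j} = mk⇔ parts
  (λ C → glue-cover wedge (iterated-connected (conn ∘ inject₁) w) (conn _)
           (from V-cover (C ∘ inject₁)) (C _))
  where
  V-cover : TreeCover V j ⇔ (∀ i → TreeCover (G (inject₁ i)) j)
  V-cover = iterated-cover (conn ∘ inject₁) w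

  parts : TreeCover W j → ∀ i → TreeCover (G i) j
  parts C i with view i
  -- The last graph is the right side of the last wedge.
  ... | ‵fromℕ     = restrict-cover (swap wedge) C
  ... | ‵inject₁ i′ = to V-cover (restrict-cover wedge C) i′

-- `gscat-isLeast` asks for a vertex: a single graph offers an end of an edge, a wedge its wedge
-- point.
iterated-vertex : ∀ {m G W} → (∀ i → HasEdge (G i)) → IteratedWedge m G W → Fin (order W)
iterated-vertex edge base               = proj₁ (edge zero)
iterated-vertex edge (step w v g wedge) = IsWedge.left wedge v

gscat-cover : ∀ G → Fin (order G) → TreeCover G (gscat (complex G))
gscat-cover G v = cover⇒treeCover (proj₁ (gscat-isLeast (complex G) (inj₁ (v , refl))))

gscat-least : ∀ G → Fin (order G) → ∀ {j} → TreeCover G j → gscat (complex G) ≤ j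
gscat-least G v C =
  proj₂ (gscat-isLeast (complex G) (inj₁ (v , refl))) _ (treeCover⇒cover C)

corollary19 : ∀ (m : ℕ) (G : Fin (suc m) → Graph) →
    (∀ i → Connected (G i)) →
    (∀ i → HasEdge (G i)) →
    ∀ (W : Graph) → IteratedWedge m G W →
    gscat (complex W) ≡ max 0 (tabulate (λ i → gscat (complex (G i))))
corollary19 m G conn edge W w = ≤-antisym
  -- Upper bound: a least cover of each graph is padded to the maximal size before gluing.
  (gscat-least W v (from (iterated-cover conn w) λ i →
    cover-mono (≤⇒≤′ (tabulate⁻ {f = cat} (xs≤max 0 (tabulate cat)) i))
               (gscat-cover (G i) (proj₁ (edge i)))))
  -- Lower bound: a least cover of `W` restricts to every graph. The starting value 0 of `max` is
  -- bounded by `z≤n`.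
  (max≤v⁺ z≤n (tabulate⁺ {f = cat} λ i →
    gscat-least (G i) (proj₁ (edge i)) (to (iterated-cover conn w) (gscat-cover W v) i)))
  where
  v : Fin (order W)
  v = iterated-vertex edge w

  cat : Fin (suc m) → ℕ
  cat i = gscat (complex (G i))
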